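{- Let $\Sigma$ be a signature and $\mathbf V$ a full subcategory of $\mathbf{Alg}(\Sigma)$. (1) $\mathbf V$ is closed under surjective images, small products and strong subobjects if and only if there exists a class $\{\Lambda_e\}_{e\in\mathbb E}$ of unconditional theories, each $\Lambda_e$ in some language $(\Sigma,X_e)$, such that for every $\Sigma$-algebra $\mathcal A$: $\mathcal A\in\mathbf V$ iff $\mathcal A$ is a model of $\Lambda_e$ for all $e\in\mathbb E$. (2) $\mathbf V$ is closed under split surjective images, small products and strong subobjects if and only if there exists a class $\{\Lambda_e\}_{e\in\mathbb E}$ of theories of type $\mathsf E$, each $\Lambda_e$ in some language $(\Sigma,X_e)$, such that for every $\Sigma$-algebra $\mathcal A$: $\mathcal A\in\mathbf V$ iff $\mathcal A$ is a model of $\Lambda_e$ for all $e\in\mathbb E$.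
   Context: $H$ is a frame with bottom $\bot$. An $H$-fuzzy set is a pair $(A,\mu_A)$ of a set $A$ and a function $\mu_A:A\to H$; an arrow $f:(A,\mu_A)\to(B,\mu_B)$ is a function with $\mu_A(x)\le\mu_B(f(x))$; they form $\mathbf{Fuz}_H$. For $n\ge1$, $(A,\mu_A)^n=(A^n,\mu)$ with $\mu(a_1,\dots,a_n)=\bigwedge_i\mu_A(a_i)$. A signature $\Sigma=(O,\mathrm{ar},C)$ consists of a set $O$ of operation symbols with arity $\mathrm{ar}:O\to\{1,2,3,\dots\}$ and a set $C$ of constant symbols. A language is a pair $\mathcal L=(\Sigma,X)$ with $X$ a set of variables. $\mathrm{Terms}(\mathcal L)$ is the smallest set containing $X\sqcup C$ and containing $f(t_1,\dots,t_{\mathrm{ar}(f)})$ whenever $f\in O$ and all $t_i\in\mathrm{Terms}(\mathcal L)$. A formula is either an equation $s\equiv t$ ($s,t$ terms) or a membership proposition $\mathsf E_l(t)$ with $l\in H$ and $t$ a term. A sequent $\Gamma\vdash\psi$ is a pair of a (possibly infinite) set $\Gamma$ of formulas and a formula $\psi$; $\vdash\psi$ means $\emptyset\vdash\psi$. A fuzzy theory in $\mathcal L$ is a set of sequents. A theory is unconditional if all its sequents have the form $\vdash\phi$; it is of type $\mathsf E$ if all its sequents have the form $\{\mathsf E_{l_i}(x_i)\}_{i\in I}\vdash\phi$ with $x_i\in X$ variables and $l_i\in H$. A $\Sigma$-algebra $\mathcal A=((A,\mu_A),\Sigma^{\mathcal A})$ is an $H$-fuzzy set $(A,\mu_A)$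 together with, for each $f\in O$, an arrow $f^{\mathcal A}:(A,\mu_A)^{\mathrm{ar}(f)}\to(A,\mu_A)$ of $\mathbf{Fuz}_H$ and, for each $c\in C$, an element $c^{\mathcal A}\in A$. A morphism of $\Sigma$-algebras is an arrow of $\mathbf{Fuz}_H$ between the carriers preserving all constants and commuting with all operations; this gives $\mathbf{Alg}(\Sigma)$, whose products are the products of carriers in $\mathbf{Fuz}_H$ (membership the infimum of the components) with componentwise operations and constants. An assignment is a function $\iota:X\to A$; evaluation: $x^{\mathcal A,\iota}=\iota(x)$, $c^{\mathcal A,\iota}=c^{\mathcal A}$, $f(t_1,\dots,t_n)^{\mathcal A,\iota}=f^{\mathcal A}(t_1^{\mathcal A,\iota},\dots,t_n^{\mathcal A,\iota})$. $\mathcal A\vDash_\iota s\equiv t$ iff $s^{\mathcal A,\iota}=t^{\mathcal A,\iota}$; $\mathcal A\vDash_\iota\mathsf E_l(t)$ iff $l\le\mu_A(t^{\mathcal A,\iota})$. $\mathcal A$ satisfies $\Gamma\vdash\psi$ if for every assignment $\iota$ with $\mathcal A\vDash_\iota\phi$ for all $\phi\in\Gamma$ one has $\mathcal A\vDash_\iota\psi$. $\mathcal A$ is a model of a theory $\Lambda$ if it satisfies every sequent of $\Lambda$. Closure conditions on $\mathbf V$: closed under surjective images means that if $\mathcal A\in\mathbf V$ and $e:\mathcal A\to\mathcal B$ is a morphism with surjective underlying function then $\mathcal B\in\mathbf V$; closed under split surjective images means the same for morphisms $e$ whose underlying arrow has a right inverse in $\mathbf{Fuz}_H$; closed under strong subobjects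 means that if $\mathcal B\in\mathbf V$ and $m:\mathcal A\to\mathcal B$ is a morphism whose underlying function is injective with $\mu_B(m(a))=\mu_A(a)$ for all $a$, then $\mathcal A\in\mathbf V$; closed under small products means the product of any set-indexed family of members of $\mathbf V$ is in $\mathbf V$. -}

module Defs where

open import Level using (Level; Lift; lift; _⊔_) renaming (suc to lsuc)
open import Data.Nat.Base using (ℕ; NonZero)
open import Data.Fin.Base using (Fin)
open import Data.Product.Base using (Σ; Σ-syntax; ∃-syntax; _×_; _,_; proj₁; proj₂)
open import Function.Definitions using (Injective; Surjective)
open import Relation.Binary.Lattice.Bundles using (BoundedMeetSemilattice)
open import Relation.Binary.PropositionalEquality.Core using (_≡_)
open import Relation.Unary using (Pred; _∈_; _≐_; ∅)

-- Throughout, "set" means a type in Set ℓ, with _≡_ as its equality; proper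
-- classes live in larger universes.

record Frame (ℓ : Level) : Set (lsuc ℓ) where
  field
    boundedMeetSemilattice : BoundedMeetSemilattice ℓ ℓ ℓ

  open BoundedMeetSemilattice boundedMeetSemilattice public

  field
    ⋁          : {I : Set ℓ} → (I → Carrier) → Carrier
    ⋁-upper    : {I : Set ℓ} (h : I → Carrier) → ∀ i → h i ≤ ⋁ h
    ⋁-least    : {I : Set ℓ} (h : I → Carrier) → ∀ u → (∀ i → h i ≤ u) → ⋁ h ≤ u
    ∧-distrib-⋁ : {I : Set ℓ} (x : Carrier) (h : I → Carrier) →
                  x ∧ ⋁ h ≈ ⋁ (λ i → x ∧ h i)

  -- The infimum is the supremum of all lower bounds.
  ⋀ : {I : Set ℓ} → (I → Carrier) → Carrier
  ⋀ {I} h = ⋁ {Σ[ l ∈ Carrier ] (∀ i → l ≤ h i)} proj₁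

  ⋀-lower : {I : Set ℓ} (h : I → Carrier) → ∀ i → ⋀ h ≤ h i
  ⋀-lower h i = ⋁-least proj₁ (h i) (λ l → proj₂ l i)

  ⋀-greatest : {I : Set ℓ} (h : I → Carrier) → ∀ l → (∀ i → l ≤ h i) → l ≤ ⋀ h
  ⋀-greatest h l l≤h = ⋁-upper proj₁ (l , l≤h)

record Signature (ℓ : Level) : Set (lsuc ℓ) where
  field
    Op         : Set ℓ
    ar         : Op → ℕ
    ar-nonZero : ∀ f → NonZero (ar f)
    Const      : Set ℓ

module _ {ℓ : Level} (H : Frame ℓ) where

  open Frame H using (_≤_; _≈_; ⋀; ⋀-lower; ⋀-greatest) renaming (Carrier to ∣H∣; trans to ≤-trans)

  record FuzzySet : Set (lsuc ℓ) where
    field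
      Carrier : Set ℓ
      μ       : Carrier → ∣H∣

  record FuzzyMap (A B : FuzzySet) : Set ℓ where
    private
      module A = FuzzySet A
      module B = FuzzySet B
    field
      to     : A.Carrier → B.Carrier
      μ-mono : ∀ x → A.μ x ≤ B.μ (to x)

  Power : FuzzySet → ℕ → FuzzySet
  Power A n = record
    { Carrier = Fin n → A.Carrier
    ; μ       = λ a → ⋀ {Lift ℓ (Fin n)} (λ (lift i) → A.μ (a i))
    }
    where module A = FuzzySet A

  Product : {I : Set ℓ} → (I → FuzzySet) → FuzzySet
  Product {I} A = record
    { Carrier = ∀ i → FuzzySet.Carrier (A i)
    ; μ       = λ a → ⋀ (λ i → FuzzySet.μ (A i) (a i))
    }

  module _ (S : Signature ℓ) where

    open Signature S

    record Algebra : Set (lsuc ℓ) where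
      field
        fuzzySet : FuzzySet
      open FuzzySet fuzzySet public
      field
        opArrow : (f : Op) → FuzzyMap (Power fuzzySet (ar f)) fuzzySet
        const   : Const → Carrier
      op : (f : Op) → (Fin (ar f) → Carrier) → Carrier
      op f = FuzzyMap.to (opArrow f)

    record Morphism (A B : Algebra) : Set ℓ where
      private
        module A = Algebra A
        module B = Algebra B
      field
        arrow : FuzzyMap A.fuzzySet B.fuzzySet
      open FuzzyMap arrow public
      field
        preserves-const : ∀ c → to (A.const c) ≡ B.const c
        preserves-op    : ∀ f (a : Fin (ar f) → A.Carrier) →
                          to (A.op f a) ≡ B.op f (λ j → to (a j))

    ProductAlgebra : {I : Set ℓ} → (I → Algebra) → Algebra
    ProductAlgebra {I} A = record
      { fuzzySet = Product (λ i → Algebra.fuzzySet (A i))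
      ; opArrow  = λ f → record
          { to     = λ a i → Algebra.op (A i) f (λ j → a j i)
          ; μ-mono = λ a → ⋀-greatest _ _ (λ i →
              ≤-trans
                (⋀-greatest _ _ (λ (lift j) → ≤-trans (⋀-lower _ (lift j)) (⋀-lower _ i)))
                (FuzzyMap.μ-mono (Algebra.opArrow (A i) f) (λ j → a j i)))
          }
      ; const    = λ c i → Algebra.const (A i) c
      }

    data Term (X : Set ℓ) : Set ℓ where
      var   : X → Term X
      const : Const → Term X
      op    : (f : Op) → (Fin (ar f) → Term X) → Term X

    data Formula (X : Set ℓ) : Set ℓ where
      _≡ᶠ_ : Term X → Term X → Formula X
      E    : ∣H∣ → Term X → Formula X

    record Sequent (X : Set ℓ) : Set (lsuc ℓ) where
      constructor _⊢_
      field
        premises   : Pred (Formula X) ℓ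
        conclusion : Formula X

    Theory : Set ℓ → Set (lsuc ℓ)
    Theory X = Pred (Sequent X) ℓ

    Unconditional : {X : Set ℓ} → Theory X → Set (lsuc ℓ)
    Unconditional Λ = ∀ {Γ ψ} → (Γ ⊢ ψ) ∈ Λ → Γ ≐ ∅

    TypeE : {X : Set ℓ} → Theory X → Set (lsuc ℓ)
    TypeE {X} Λ = ∀ {Γ ψ} → (Γ ⊢ ψ) ∈ Λ →
      Σ[ I ∈ Set ℓ ] Σ[ l ∈ (I → ∣H∣) ] Σ[ x ∈ (I → X) ]
        Γ ≐ (λ φ → ∃[ i ] φ ≡ E (l i) (var (x i)))

    module _ (A : Algebra) where

      private module A = Algebra A

      eval : {X : Set ℓ} → (X → A.Carrier) → Term X → A.Carrier
      eval ι (var x)   = ι x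
      eval ι (const c) = A.const c
      eval ι (op f t)  = A.op f (λ j → eval ι (t j))

      Holds : {X : Set ℓ} → (X → A.Carrier) → Formula X → Set ℓ
      Holds ι (s ≡ᶠ t) = eval ι s ≡ eval ι t
      Holds ι (E l t)  = l ≤ A.μ (eval ι t)

      Satisfies : {X : Set ℓ} → Sequent X → Set ℓ
      Satisfies {X} (Γ ⊢ ψ) = (ι : X → A.Carrier) → (∀ {φ} → φ ∈ Γ → Holds ι φ) → Holds ι ψ

      IsModel : {X : Set ℓ} → Theory X → Set (lsuc ℓ)
      IsModel Λ = ∀ {σ} → σ ∈ Λ → Satisfies σ

    module _ {A B : Algebra} (h : Morphism A B) where

      private
        module A = Algebra A
        module B = Algebra B
        module h = Morphism h

      IsSurjective : Set ℓ
      IsSurjective = Surjective _≡_ _≡_ h.to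

      -- The right inverse is only an arrow of fuzzy sets, not an algebra morphism.
      IsSplitSurjective : Set ℓ
      IsSplitSurjective = Σ[ s ∈ FuzzyMap B.fuzzySet A.fuzzySet ]
        (∀ b → h.to (FuzzyMap.to s b) ≡ b)

      IsStrongMono : Set ℓ
      IsStrongMono = Injective _≡_ _≡_ h.to × (∀ a → B.μ (h.to a) ≈ A.μ a)

    -- A full subcategory of the category of algebras is given by its class of objects.
    module _ {v : Level} (V : Pred Algebra v) where

      ClosedUnderSurjectiveImages : Set (lsuc ℓ ⊔ v)
      ClosedUnderSurjectiveImages =
        ∀ {A B} (e : Morphism A B) → IsSurjective e → A ∈ V → B ∈ V

      ClosedUnderSplitSurjectiveImages : Set (lsuc ℓ ⊔ v)
      ClosedUnderSplitSurjectiveImages =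
        ∀ {A B} (e : Morphism A B) → IsSplitSurjective e → A ∈ V → B ∈ V

      ClosedUnderStrongSubobjects : Set (lsuc ℓ ⊔ v)
      ClosedUnderStrongSubobjects =
        ∀ {A B} (m : Morphism A B) → IsStrongMono m → B ∈ V → A ∈ V

      ClosedUnderSmallProducts : Set (lsuc ℓ ⊔ v)
      ClosedUnderSmallProducts =
        ∀ {I : Set ℓ} (A : I → Algebra) → (∀ i → A i ∈ V) → ProductAlgebra A ∈ V

-- Each model condition transfers along the closure operations because morphisms
-- preserve formulas, strong monomorphisms also reflect them, and a product
-- satisfies a formula exactly when all its components do; premises of the form
-- E l x are moreover pulled back along a section of fuzzy sets.
--
-- Conversely, given an algebra A, take the elements of A as variables and let Γ be
-- empty (part 1) or consist of all E (μ a) a (part 2).  For every formula φ such that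
-- Γ ⊢ φ fails somewhere in V choose a refuting algebra and assignment.  The
-- subalgebra T generated by the variables in the product of these algebras lies
-- in V, and whatever holds in T at its generators is a V-consequence of Γ, hence
-- holds in A.  So sending generators to themselves gives a morphism T → A, which
-- has a section a ↦ a, and this section is an arrow of fuzzy sets when Γ contains
-- every E (μ a) a.
module Submission where

open import Defs
open import Level using (Level; Lift; lift; lower; _⊔_) renaming (suc to lsuc)
open import Data.Bool.Properties using (T-irrelevant)
open import Data.Empty using (⊥-elim)
open import Data.Fin.Base using (Fin)
open import Data.Product.Base using (Σ-syntax; ∃-syntax; _×_; _,_; proj₁; proj₂)
open import Function.Base using (id; _∘_)
open import Function.Bundles using (_⇔_; mk⇔; Equivalence)
open import Relation.Binary.PropositionalEquality using (_≡_; refl; sym; trans; cong; subst)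
open import Relation.Nullary using (¬_)
open import Relation.Nullary.Decidable using (True; toWitness; fromWitness; decidable-stable)
open import Relation.Unary using (Pred; _∈_; _≐_; ∅)
open import Axiom.ExcludedMiddle using (ExcludedMiddle)
open import Axiom.Extensionality.Propositional using (Extensionality)

-- Proof-irrelevant truncation from excluded middle.

module Classical (em : ∀ {a} → ExcludedMiddle a) where

  -- A proof-irrelevant copy of P in an arbitrary universe.  As excluded middle is
  -- assumed for all types, P can be recovered from it, which amounts to choice.
  Squash : ∀ {p} ℓ → Set p → Set ℓ
  Squash ℓ P = Lift ℓ (True (em {P = P}))

  squash : ∀ {p ℓ} {P : Set p} → P → Squash ℓ P
  squash p = lift (fromWitness p)

  unsquash : ∀ {p ℓ} {P : Set p} → Squash ℓ P → P
  unsquash s = toWitness (lower s)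

  squash-irrelevant : ∀ {p ℓ} {P : Set p} (s t : Squash ℓ P) → s ≡ t
  squash-irrelevant (lift s) (lift t) = cong lift (T-irrelevant s t)

module _ (ext : ∀ {a b} → Extensionality a b)
         {ℓ : Level} (H : Frame ℓ) (S : Signature ℓ) where

  open Frame H using (_≤_; ⋀-lower; ⋀-greatest)
    renaming (Carrier to ∣H∣; refl to ≤-refl; trans to ≤-trans; reflexive to ≤-reflexive; module Eq to ≈)
  open Signature S

  private
    module Alg = Algebra
    module Mor = Morphism

  -- Formulas under morphisms and products.

  to-eval : ∀ {A B} (h : Morphism H S A B) {X : Set ℓ} (ι : X → Alg.Carrier A) t →
            Mor.to h (eval H S A ι t) ≡ eval H S B (Mor.to h ∘ ι) t
  to-eval h ι (var x)   = refl
  to-eval h ι (const c) = Mor.preserves-const h c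
  to-eval {B = B} h ι (op f t) =
    trans (Mor.preserves-op h f _) (cong (Alg.op B f) (ext (λ j → to-eval h ι (t j))))

  Holds-image : ∀ {A B} (h : Morphism H S A B) {X : Set ℓ} (ι : X → Alg.Carrier A) φ →
                Holds H S A ι φ → Holds H S B (Mor.to h ∘ ι) φ
  Holds-image h ι (s ≡ᶠ t) s≡t = trans (sym (to-eval h ι s)) (trans (cong (Mor.to h) s≡t) (to-eval h ι t))
  Holds-image {B = B} h ι (E l t) l≤ =
    subst (λ b → l ≤ Alg.μ B b) (to-eval h ι t) (≤-trans l≤ (Mor.μ-mono h _))

  Holds-preimage : ∀ {A B} (m : Morphism H S A B) → IsStrongMono H S m →
                   {X : Set ℓ} (ι : X → Alg.Carrier A) → ∀ φ →
                   Holds H S B (Mor.to m ∘ ι) φ → Holds H S A ι φ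
  Holds-preimage m (inj , _) ι (s ≡ᶠ t) s≡t =
    inj (trans (to-eval m ι s) (trans s≡t (sym (to-eval m ι t))))
  Holds-preimage {B = B} m (_ , μ≈) ι (E l t) l≤ =
    ≤-trans (subst (λ b → l ≤ Alg.μ B b) (sym (to-eval m ι t)) l≤) (≤-reflexive (μ≈ _))

  module _ {I : Set ℓ} (A : I → Algebra H S) where

    projection : ∀ i → Morphism H S (ProductAlgebra H S A) (A i)
    projection i = record
      { arrow           = record { to = λ a → a i ; μ-mono = λ a → ⋀-lower _ i }
      ; preserves-const = λ c → refl
      ; preserves-op    = λ f a → refl
      }

    Holds-product : {X : Set ℓ} (ι : X → Alg.Carrier (ProductAlgebra H S A)) → ∀ φ →
                    (∀ i → Holds H S (A i) (λ x → ι x i) φ) → Holds H S (ProductAlgebra H S A) ι φ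
    Holds-product ι (s ≡ᶠ t) s≡t = ext λ i →
      trans (to-eval (projection i) ι s) (trans (s≡t i) (sym (to-eval (projection i) ι t)))
    Holds-product ι (E l t) l≤ = ⋀-greatest _ _ λ i →
      subst (λ b → l ≤ Alg.μ (A i) b) (sym (to-eval (projection i) ι t)) (l≤ i)

  -- Sequents under products, strong subobjects and images.

  Satisfies-product : {I : Set ℓ} (A : I → Algebra H S) {X : Set ℓ} (σ : Sequent H S X) →
                      (∀ i → Satisfies H S (A i) σ) → Satisfies H S (ProductAlgebra H S A) σ
  Satisfies-product A (Γ ⊢ ψ) sat ι Γ-holds = Holds-product A ι ψ λ i →
    sat i _ (λ {φ} φ∈Γ → Holds-image (projection A i) ι φ (Γ-holds φ∈Γ))

  Satisfies-strongSub : ∀ {A B} (m : Morphism H S A B) → IsStrongMono H S m →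
                        {X : Set ℓ} (σ : Sequent H S X) → Satisfies H S B σ → Satisfies H S A σ
  Satisfies-strongSub m strong (Γ ⊢ ψ) sat ι Γ-holds = Holds-preimage m strong ι ψ
    (sat _ (λ {φ} φ∈Γ → Holds-image m ι φ (Γ-holds φ∈Γ)))

  -- The conclusion is obtained at `s ∘ ι` and pushed forward along `e`, which turns `s ∘ ι` back
  -- into `ι`. Only lifting the premises constrains `s`, so a bare function suffices.
  Satisfies-section : ∀ {A B} (e : Morphism H S A B) (s : Alg.Carrier B → Alg.Carrier A) →
                      (∀ b → Mor.to e (s b) ≡ b) → {X : Set ℓ} (Γ : Pred (Formula H S X) ℓ) → ∀ ψ →
                      (∀ ι → (∀ {φ} → φ ∈ Γ → Holds H S B ι φ) → ∀ {φ} → φ ∈ Γ → Holds H S A (s ∘ ι) φ) →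
                      Satisfies H S A (Γ ⊢ ψ) → Satisfies H S B (Γ ⊢ ψ)
  Satisfies-section {B = B} e s e∘s≡id Γ ψ lift-Γ sat ι Γ-holds =
    subst (λ κ → Holds H S B κ ψ) (ext (e∘s≡id ∘ ι))
      (Holds-image e _ ψ (sat (s ∘ ι) (lift-Γ ι Γ-holds)))

  -- The section picked from surjectivity need not respect membership degrees; with no premises
  -- there is nothing to lift.
  Satisfies-surjective : ∀ {A B} (e : Morphism H S A B) → IsSurjective H S e →
                         {X : Set ℓ} (Γ : Pred (Formula H S X) ℓ) → ∀ ψ → Γ ≐ ∅ →
                         Satisfies H S A (Γ ⊢ ψ) → Satisfies H S B (Γ ⊢ ψ)
  Satisfies-surjective e surj Γ ψ Γ≐∅ = Satisfies-section e (proj₁ ∘ surj) (λ b → proj₂ (surj b) refl) Γ ψ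
    (λ _ _ φ∈Γ → ⊥-elim (proj₁ Γ≐∅ φ∈Γ))

  -- The premises concern variables only, so monotonicity of the section lifts them although it need
  -- not commute with the operations.
  Satisfies-splitSurjective : ∀ {A B} (e : Morphism H S A B) → IsSplitSurjective H S e →
    {X : Set ℓ} (Γ : Pred (Formula H S X) ℓ) → ∀ ψ →
    {I : Set ℓ} (l : I → ∣H∣) (x : I → X) → Γ ≐ (λ φ → ∃[ i ] φ ≡ E (l i) (var (x i))) →
    Satisfies H S A (Γ ⊢ ψ) → Satisfies H S B (Γ ⊢ ψ)
  Satisfies-splitSurjective {A} e (s , e∘s≡id) Γ ψ l x (Γ⊆ , ⊆Γ) =
    Satisfies-section e (FuzzyMap.to s) e∘s≡id Γ ψ λ ι Γ-holds φ∈Γ →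
      let i , φ≡ = Γ⊆ φ∈Γ
      in subst (Holds H S A _) (sym φ≡) (≤-trans (Γ-holds (⊆Γ (i , refl))) (FuzzyMap.μ-mono s _))

  -- Closure properties of model classes.

  module _ {v : Level} {V : Pred (Algebra H S) v}
           {𝔼 : Set (lsuc ℓ ⊔ v)} {X : 𝔼 → Set ℓ} {Λ : (e : 𝔼) → Theory H S (X e)}
           (models : ∀ A → (A ∈ V) ⇔ (∀ e → IsModel H S A (Λ e))) where

    private
      module M A = Equivalence (models A)

    models-closedUnderProducts : ClosedUnderSmallProducts H S V
    models-closedUnderProducts A A∈V =
      M.from _ λ e {σ} σ∈Λ → Satisfies-product A σ (λ i → M.to (A i) (A∈V i) e σ∈Λ)

    models-closedUnderStrongSubobjects : ClosedUnderStrongSubobjects H S V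
    models-closedUnderStrongSubobjects m strong B∈V =
      M.from _ λ e {σ} σ∈Λ → Satisfies-strongSub m strong σ (M.to _ B∈V e σ∈Λ)

    models-closedUnderSurjectiveImages :
      (∀ e → Unconditional H S (Λ e)) → ClosedUnderSurjectiveImages H S V
    models-closedUnderSurjectiveImages uncond h surj A∈V =
      M.from _ λ { e {Γ ⊢ ψ} σ∈Λ →
        Satisfies-surjective h surj Γ ψ (uncond e σ∈Λ) (M.to _ A∈V e σ∈Λ) }

    models-closedUnderSplitSurjectiveImages :
      (∀ e → TypeE H S (Λ e)) → ClosedUnderSplitSurjectiveImages H S V
    models-closedUnderSplitSurjectiveImages typeE h split A∈V =
      M.from _ λ { e {Γ ⊢ ψ} σ∈Λ → let _ , l , x , Γ≐ = typeE e σ∈Λ in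
        Satisfies-splitSurjective h split Γ ψ l x Γ≐ (M.to _ A∈V e σ∈Λ) }

  module _ (em : ∀ {a} → ExcludedMiddle a) where

    open Classical em

    -- The subalgebra generated by a family of elements.

    module Generated (P : Algebra H S) {X : Set ℓ} (ι : X → Alg.Carrier P) where

      private module P = Algebra P

      Value : P.Carrier → Set ℓ
      Value p = ∃[ t ] eval H S P ι t ≡ p

      -- Many terms can share a value. Squashing the witness leaves an element determined by its
      -- point in `P`, as injectivity of the inclusion requires.
      carrier : FuzzySet H
      carrier = record
        { Carrier = Σ[ p ∈ P.Carrier ] Squash ℓ (Value p)
        ; μ       = P.μ ∘ proj₁
        }

      op-value : ∀ f (a : Fin (ar f) → P.Carrier) → (∀ j → Value (a j)) → Value (P.op f a)
      op-value f a t = op f (proj₁ ∘ t) , cong (P.op f) (ext (proj₂ ∘ t))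

      algebra : Algebra H S
      algebra = record
        { fuzzySet = carrier
        ; opArrow  = λ f → record
            { to     = λ a → P.op f (proj₁ ∘ a) , squash (op-value f (proj₁ ∘ a) (λ j → unsquash (proj₂ (a j))))
            ; μ-mono = λ a → FuzzyMap.μ-mono (P.opArrow f) (proj₁ ∘ a)
            }
        ; const    = λ c → P.const c , squash (const c , refl)
        }

      inclusion : Morphism H S algebra P
      inclusion = record
        { arrow           = record { to = proj₁ ; μ-mono = λ _ → ≤-refl }
        ; preserves-const = λ c → refl
        ; preserves-op    = λ f a → refl
        }

      inclusion-strongMono : IsStrongMono H S inclusion
      inclusion-strongMono = proj₁-injective , λ _ → ≈.refl
        where
        proj₁-injective : ∀ {p q} → proj₁ p ≡ proj₁ q → p ≡ q
        proj₁-injective {p , s} {.p , t} refl = cong (p ,_) (squash-irrelevant s t)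

      generator : X → Alg.Carrier algebra
      generator x = ι x , squash (var x , refl)

      module Extend (A : Algebra H S) (κ : X → Alg.Carrier A)
                    (transfer : ∀ φ → Holds H S P ι φ → Holds H S A κ φ) where

        private module A = Algebra A

        extend : Alg.Carrier algebra → A.Carrier
        extend (_ , s) = eval H S A κ (proj₁ (unsquash s))

        -- Independence of the chosen term: both terms have the same value in `P`, and that equation
        -- transfers to `A`.
        extend-eval : ∀ q t → eval H S P ι t ≡ proj₁ q → extend q ≡ eval H S A κ t
        extend-eval (_ , s) t t≡ = transfer (proj₁ (unsquash s) ≡ᶠ t) (trans (proj₂ (unsquash s)) (sym t≡))

        morphism : Morphism H S algebra A
        morphism = record
          { arrow           = record
              { to     = extend
              ; μ-mono = λ (p , s) → let t , t≡p = unsquash s in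
                  -- The level is the degree of `p` in `P` itself, so the formula holds there by
                  -- reflexivity.
                  transfer (E (P.μ p) t) (subst (λ q → P.μ p ≤ P.μ q) (sym t≡p) ≤-refl)
              }
          ; preserves-const = λ c → extend-eval _ (const c) refl
          ; preserves-op    = λ f a →
              -- `t` is assembled from the terms already chosen for the arguments, so its value in
              -- `A` unfolds to the operation applied to their images.
              let t = op-value f (proj₁ ∘ a) (λ j → unsquash (proj₂ (a j)))
              in extend-eval _ (proj₁ t) (proj₂ t)
          }

        morphism-generator : ∀ x → extend (generator x) ≡ κ x
        morphism-generator x = extend-eval (generator x) (var x) refl

    module _ {v : Level} (V : Pred (Algebra H S) v) where

      -- Consequence over `V` and the product of refuting algebras.

      Valid : {X : Set ℓ} → Sequent H S X → Set (lsuc ℓ ⊔ v)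
      Valid σ = ∀ B → B ∈ V → Satisfies H S B σ

      module Universal {X : Set ℓ} (Γ : Pred (Formula H S X) ℓ) where

        record Refutation (φ : Formula H S X) : Set (lsuc ℓ ⊔ v) where
          field
            algebra    : Algebra H S
            member     : algebra ∈ V
            assignment : X → Alg.Carrier algebra
            premises   : ∀ {χ} → χ ∈ Γ → Holds H S algebra assignment χ
            fails      : ¬ Holds H S algebra assignment φ

        -- `Refutation φ` is a large type. One squashed choice per formula keeps the index type of
        -- the product small.
        Refuted : Set ℓ
        Refuted = Σ[ φ ∈ Formula H S X ] Squash ℓ (Refutation φ)

        module R (r : Refuted) = Refutation (unsquash (proj₂ r))

        product : Algebra H S
        product = ProductAlgebra H S R.algebra

        universal : X → Alg.Carrier product
        universal x r = R.assignment r x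

        universal-premises : ∀ {φ} → φ ∈ Γ → Holds H S product universal φ
        universal-premises {φ} φ∈Γ = Holds-product R.algebra universal φ (λ r → R.premises r φ∈Γ)

        universal-valid : ∀ φ → Holds H S product universal φ → Valid (Γ ⊢ φ)
        universal-valid φ holds B B∈V ι Γ-holds = decidable-stable em λ ¬holds →
          -- The counterexample makes `φ` an index. The algebra chosen there may differ from `B`,
          -- but it refutes `φ` too, contradicting the projection of `holds`.
          let r = φ , squash (record { algebra = B ; member = B∈V ; assignment = ι
                                     ; premises = Γ-holds ; fails = ¬holds })
          in R.fails r (Holds-image (projection R.algebra r) universal φ holds)

        open Generated product universal public

        algebra∈V : ClosedUnderSmallProducts H S V → ClosedUnderStrongSubobjects H S V → algebra ∈ V
        algebra∈V prod sub = sub inclusion inclusion-strongMono (prod R.algebra R.member)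

      -- Axiomatization by valid sequents, one theory per algebra.

      module Axiomatization (Γ : (A : Algebra H S) → Pred (Formula H S (Alg.Carrier A)) ℓ) where

        Index : Set (lsuc ℓ ⊔ v)
        Index = Lift (lsuc ℓ ⊔ v) (Algebra H S)

        Vars : Index → Set ℓ
        Vars (lift A) = Alg.Carrier A

        -- Validity quantifies over all of `V` and is large; squashing brings it down to the level
        -- that `Theory` demands.
        theory : (e : Index) → Theory H S (Vars e)
        theory (lift A) σ = Squash ℓ (Sequent.premises σ ≡ Γ A × Valid σ)

        theory-premises : ∀ A σ → σ ∈ theory (lift A) → Sequent.premises σ ≡ Γ A
        theory-premises A σ σ∈Λ = proj₁ (unsquash σ∈Λ)

        V⊆models : ∀ A → A ∈ V → ∀ e → IsModel H S A (theory e)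
        V⊆models A A∈V e σ∈Λ = proj₂ (unsquash σ∈Λ) A A∈V

        module Cover (Γ-holds : ∀ A {φ} → φ ∈ Γ A → Holds H S A id φ)
                     (A : Algebra H S) (model : ∀ e → IsModel H S A (theory e)) where

          open Universal (Γ A) public

          -- A formula true at `universal` is a consequence of `Γ A`, hence in the theory indexed by
          -- `A`. The identity assignment satisfies `Γ A`, so the formula holds there.
          open Extend A id (λ φ holds →
            model (lift A) {Γ A ⊢ φ} (squash (refl , universal-valid φ holds)) id (Γ-holds A)) public

          surjective : IsSurjective H S morphism
          surjective a = generator a , λ { refl → morphism-generator a }

          splitSurjective : (∀ a → E (Alg.μ A a) (var a) ∈ Γ A) → IsSplitSurjective H S morphism
          splitSurjective Eμ∈Γ =
            -- The premise for `a`, true at `universal`, says precisely that `generator` does not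
            -- lower the degree of `a`.
            record { to = generator ; μ-mono = λ a → universal-premises (Eμ∈Γ a) } , morphism-generator

      -- The two premise families and their axiomatizations.

      noPremises : (A : Algebra H S) → Pred (Formula H S (Alg.Carrier A)) ℓ
      noPremises A φ = Lift ℓ (φ ∈ ∅)

      memberships : (A : Algebra H S) → Pred (Formula H S (Alg.Carrier A)) ℓ
      memberships A φ = ∃[ a ] φ ≡ E (Alg.μ A a) (var a)

      unconditional-axiomatization :
        ClosedUnderSurjectiveImages H S V → ClosedUnderSmallProducts H S V → ClosedUnderStrongSubobjects H S V →
        let open Axiomatization noPremises in
        (∀ e → Unconditional H S (theory e)) × (∀ A → (A ∈ V) ⇔ (∀ e → IsModel H S A (theory e)))
      unconditional-axiomatization img prod sub =
          (λ (lift A) {Δ} {ψ} σ∈Λ → subst (_≐ ∅) (sym (theory-premises A (Δ ⊢ ψ) σ∈Λ)) (lower , lift))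
        , (λ A → mk⇔ (V⊆models A) λ model →
            let open Cover (λ _ ()) A model in img morphism surjective (algebra∈V prod sub))
        where open Axiomatization noPremises

      typeE-axiomatization :
        ClosedUnderSplitSurjectiveImages H S V → ClosedUnderSmallProducts H S V → ClosedUnderStrongSubobjects H S V →
        let open Axiomatization memberships in
        (∀ e → TypeE H S (theory e)) × (∀ A → (A ∈ V) ⇔ (∀ e → IsModel H S A (theory e)))
      typeE-axiomatization img prod sub =
          (λ (lift A) {Δ} {ψ} σ∈Λ → Alg.Carrier A , Alg.μ A , id ,
            subst (_≐ memberships A) (sym (theory-premises A (Δ ⊢ ψ) σ∈Λ)) (id , id))
        , (λ A → mk⇔ (V⊆models A) λ model →
            let open Cover (λ { _ (_ , refl) → ≤-refl }) A model
            in img morphism (splitSurjective (λ a → a , refl)) (algebra∈V prod sub))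
        where open Axiomatization memberships

theorem55 :
  (∀ {a} → ExcludedMiddle a) →
  (∀ {a b} → Extensionality a b) →
  ∀ {ℓ v : Level} (H : Frame ℓ) (S : Signature ℓ) (V : Pred (Algebra H S) v) →
    ((ClosedUnderSurjectiveImages H S V × ClosedUnderSmallProducts H S V × ClosedUnderStrongSubobjects H S V)
      ⇔
      (Σ[ 𝔼 ∈ Set (lsuc ℓ ⊔ v) ] Σ[ X ∈ (𝔼 → Set ℓ) ] Σ[ Λ ∈ ((e : 𝔼) → Theory H S (X e)) ]
        ((∀ e → Unconditional H S (Λ e)) ×
         (∀ A → (A ∈ V) ⇔ (∀ e → IsModel H S A (Λ e))))))
    ×
    ((ClosedUnderSplitSurjectiveImages H S V × ClosedUnderSmallProducts H S V × ClosedUnderStrongSubobjects H S V)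
      ⇔
      (Σ[ 𝔼 ∈ Set (lsuc ℓ ⊔ v) ] Σ[ X ∈ (𝔼 → Set ℓ) ] Σ[ Λ ∈ ((e : 𝔼) → Theory H S (X e)) ]
        ((∀ e → TypeE H S (Λ e)) ×
         (∀ A → (A ∈ V) ⇔ (∀ e → IsModel H S A (Λ e))))))
theorem55 em ext H S V =
    mk⇔ (λ (img , prod , sub) → _ , _ , _ , unconditional-axiomatization ext H S em V img prod sub)
        (λ (_ , _ , _ , uncond , models) →
            models-closedUnderSurjectiveImages ext H S models uncond
          , models-closedUnderProducts ext H S models
          , models-closedUnderStrongSubobjects ext H S models)
  , mk⇔ (λ (img , prod , sub) → _ , _ , _ , typeE-axiomatization ext H S em V img prod sub)
        (λ (_ , _ , _ , typeE , models) →
            models-closedUnderSplitSurjectiveImages ext H S models typeE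
          , models-closedUnderProducts ext H S models
          , models-closedUnderStrongSubobjects ext H S models)
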